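{- Let $\alpha\in\mathbb{N}=\{0,1,2,\dots\}$. (i) If $m$ is a positive odd integer with $m>6\alpha+2$ and $\mathbb{S}=\langle 6,6\alpha+2,m\rangle$, then $Betti(\mathbb{S})=\{18\alpha+6,\,2m\}$. (ii) If $n\in\mathbb{N}$ with $3\nmid n$ and $n>6\alpha+3$ and $\mathbb{S}=\langle 6,6\alpha+3,n\rangle$, then $Betti(\mathbb{S})=\{12\alpha+6,\,3n\}$. (iii) If $p$ is a positive odd integer with $p>6\alpha+4$ and $\mathbb{S}=\langle 6,6\alpha+4,p\rangle$, then $Betti(\mathbb{S})=\{18\alpha+12,\,2p\}$.
   Context: $\mathbb{N}$ denotes the set of nonnegative integers. For positive integers $a_1,\dots,a_e$ with $\gcd=1$, $\langle a_1,\dots,a_e\rangle=\{\lambda_1a_1+\dots+\lambda_ea_e:\lambda_i\in\mathbb{N}\}$. For $a\in\mathbb{S}$, $Z(a)=\{(\eta_1,\dots,\eta_e)\in\mathbb{N}^e:\sum\eta_ia_i=a\}$. For $x,y\in\mathbb{N}^e$, $\gcd\{x,y\}$ is the componentwise minimum. For $a\in\mathbb{S}\setminus\{0\}$, $\nabla_a$ is the graph with vertex set $Z(a)$, with $x,y$ adjacent iff $\gcd\{x,y\}\neq0$; $a$ is a Betti element if $\nabla_a$ is disconnected, and $Betti(\mathbb{S})$ is the set of Betti elements. -}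

module Defs where

open import Data.Nat using (ℕ; _*_; _⊓_)
open import Data.Product using (Σ; _×_; proj₁)
open import Data.Vec using (Vec; zipWith; sum; replicate)
open import Level using (0ℓ)
open import Relation.Binary.Core using (Rel)
open import Relation.Binary.Construct.Closure.ReflexiveTransitive using (Star)
open import Relation.Binary.PropositionalEquality using (_≡_; _≢_)
open import Relation.Nullary using (¬_)
open import Relation.Unary using (Pred; _∈_)

infix 7 _·_
_·_ : ∀ {e} → Vec ℕ e → Vec ℕ e → ℕ
x · y = sum (zipWith _*_ x y)

-- Factorizations are taken with respect to the given list of generators,
-- which need not be a minimal generating system.
Z : ∀ {e} → Vec ℕ e → ℕ → Set
Z {e} as a = Σ (Vec ℕ e) λ η → η · as ≡ a

⟨_⟩ : ∀ {e} → Vec ℕ e → Pred ℕ 0ℓ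
⟨ as ⟩ a = Z as a

gcdᵛ : ∀ {e} → Vec ℕ e → Vec ℕ e → Vec ℕ e
gcdᵛ = zipWith _⊓_

-- The adjacency relation of ∇ₐ, whose vertex type is Z as a. A nonzero vertex
-- is related to itself; such loops do not affect connectedness.
∇ : ∀ {e} (as : Vec ℕ e) (a : ℕ) → Rel (Z as a) 0ℓ
∇ {e} as a x y = gcdᵛ (proj₁ x) (proj₁ y) ≢ replicate e 0

-- Star consists of directed walks; this is graph connectedness
-- when the adjacency relation is symmetric, as ∇ is.
Connected : {V : Set} → Rel V 0ℓ → Set
Connected {V} _~_ = (x y : V) → Star _~_ x y

Disconnected : {V : Set} → Rel V 0ℓ → Set
Disconnected _~_ = ¬ Connected _~_

Betti : ∀ {e} → Vec ℕ e → Pred ℕ 0ℓ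
Betti as a = a ∈ ⟨ as ⟩ × a ≢ 0 × Disconnected (∇ as a)

{-# OPTIONS --safe #-}

-- In all three cases the generators are d a, d b, c with a, b coprime, d, c
-- coprime and c = r a + t b: the semigroup is a gluing of d⟨a,b⟩ and ⟨c⟩. The
-- exchanges d·c ↔ r·(d a) + t·(d b) and a·(d b) ↔ b·(d a) bring every
-- factorization to the unique one with y < a and z < d, and an exchange is
-- an edge of the graph unless it exhausts the factorization, which happens only
-- at the elements d c and d a b.

module Submission where

open import Data.Nat using (ℕ; zero; suc; _+_; _*_; _∸_; _⊓_; _≤_; _<_; _>_; z≤n; NonZero;
  ≢-nonZero; ≢-nonZero⁻¹; >-nonZero; >-nonZero⁻¹; _≟_; _/_; _%_)
open import Data.Nat.Coprimality using (Coprime; coprime-Bézout; coprime-divisor)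
open import Data.Nat.DivMod using (m≡m%n+[m/n]*n; m%n<n)
open import Data.Nat.Divisibility
  using (_∣_; _∤_; divides; _∣?_; ∣m+n∣m⇒∣n; m∣m*n; n∣m*n; >⇒∤; module _∣_)
open import Data.Nat.GCD using (module Bézout)
open import Data.Nat.Primality using (Prime; prime?; prime⇒irreducible; prime[2])
open import Data.Nat.Properties using (≡-irrelevant; +-cancelˡ-≡; +-cancelʳ-≡; *-cancelˡ-≡;
  ≤-total; ≤-trans; ≤-reflexive; <⇒≤; <⇒≤pred; ≤-<-trans; m≤m+n; m≤n+m; m∸n≤m; m+[n∸m]≡n;
  *-monoˡ-≤; *-comm; *-assoc; +-comm; +-assoc; +-identityʳ; ⊓-comm; ⊓-zeroʳ;
  m+n≡0⇒m≡0; m+n≡0⇒n≡0; m*n≡0⇒m≡0; m*n≡0⇒m≡0∨n≡0; m*n≢0)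
open import Data.Nat.Tactic.RingSolver using (solve-∀)
open import Data.Product using (_×_; _,_; proj₁; proj₂; ∃; ∃₂)
open import Data.Sum using (_⊎_; inj₁; inj₂)
open import Data.Vec using (Vec; []; _∷_; zipWith; map; replicate)
open import Data.Vec.Properties using (zipWith-comm; ∷-injective)
open import Relation.Binary.Construct.Closure.ReflexiveTransitive
  using (Star; ε; _◅_; _◅◅_; reverse)
open import Relation.Binary.PropositionalEquality
open import Relation.Nullary using (yes; no; contradiction)
open import Relation.Nullary.Decidable using (from-yes; from-no)
open import Relation.Unary using (_≐_; _∪_; ｛_｝)
open import Defs

open ≡-Reasoning

-- Residues and representations by two coprime generators.

∣∧<⇒≡0 : ∀ {m n} → m ∣ n → n < m → n ≡ 0
∣∧<⇒≡0 {n = zero}  _   _   = refl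
∣∧<⇒≡0 {n = suc _} m∣n n<m = contradiction m∣n (>⇒∤ n<m)

prime∧∤⇒coprime : ∀ {p n} → Prime p → p ∤ n → Coprime p n
prime∧∤⇒coprime pr p∤n (i∣p , i∣n) with prime⇒irreducible pr i∣p
... | inj₁ i≡1  = i≡1
... | inj₂ refl = contradiction i∣n p∤n

-- Modulo `m` the equation says that `m` divides `k * (y′ ∸ y)`, hence `y′ ∸ y` by coprimality, and
-- a multiple of `m` below `m` is zero. The assumption `y ≤ y′` keeps the truncated subtraction
-- faithful.
residue-unique-≤ : ∀ {m k p p′ y y′} → Coprime m k → y′ < m → y ≤ y′ →
                   m * p + y * k ≡ m * p′ + y′ * k → y ≡ y′
residue-unique-≤ {m} {k} {p} {p′} {y} {y′} cop y′<m y≤y′ eq = begin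
  y             ≡⟨ +-identityʳ y ⟨
  y + 0         ≡⟨ cong (y +_) δ≡0 ⟨
  y + (y′ ∸ y)  ≡⟨ m+[n∸m]≡n y≤y′ ⟩
  y′            ∎
  where
  δ = y′ ∸ y

  shifted : m * p ≡ m * p′ + k * δ
  shifted = +-cancelʳ-≡ (y * k) _ _ (begin
    m * p + y * k             ≡⟨ eq ⟩
    m * p′ + y′ * k           ≡⟨ cong (λ w → m * p′ + w * k) (m+[n∸m]≡n y≤y′) ⟨
    m * p′ + (y + δ) * k      ≡⟨ regroup m p′ y δ k ⟩
    m * p′ + k * δ + y * k    ∎)
    where
    regroup : ∀ m p′ y δ k → m * p′ + (y + δ) * k ≡ m * p′ + k * δ + y * k
    regroup = solve-∀

  δ≡0 : δ ≡ 0
  δ≡0 = ∣∧<⇒≡0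
    (coprime-divisor cop (∣m+n∣m⇒∣n (subst (m ∣_) shifted (m∣m*n p)) (m∣m*n p′)))
    (≤-<-trans (m∸n≤m y′ y) y′<m)

residue-unique : ∀ {m k p p′ y y′} → Coprime m k → y < m → y′ < m →
                 m * p + y * k ≡ m * p′ + y′ * k → y ≡ y′ × p ≡ p′
residue-unique {m} {k} {p} {p′} {y} {y′} cop y<m y′<m eq =
  y≡y′ ,
  *-cancelˡ-≡ p p′ m {{>-nonZero (≤-<-trans z≤n y<m)}}
    (+-cancelʳ-≡ (y * k) _ _ (trans eq (cong (λ w → m * p′ + w * k) (sym y≡y′))))
  where
  y≡y′ : y ≡ y′
  y≡y′ with ≤-total y y′
  ... | inj₁ y≤y′ = residue-unique-≤ {p = p} {p′} cop y′<m y≤y′ eq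
  ... | inj₂ y′≤y = sym (residue-unique-≤ {p = p′} {p} cop y<m y′≤y (sym eq))

-- s is c b⁻¹ modulo a; congruence is written with both sides moved so that no
-- subtraction occurs.
solve-mod : ∀ a b c .{{_ : NonZero a}} → Coprime a b →
            ∃ λ s → ∃₂ λ u v → s * b + u * a ≡ c + v * a
solve-mod (suc k) b c cop with coprime-Bézout cop
... | Bézout.-+ y x eq = c * x , 0 , c * y , (begin
  c * x * b + 0            ≡⟨ assoc c x b ⟩
  c * (x * b)              ≡⟨ cong (c *_) eq ⟨
  c * (1 + y * suc k)      ≡⟨ expand c y k ⟩
  c + c * y * suc k        ∎)
  where
  assoc : ∀ c x b → c * x * b + 0 ≡ c * (x * b)
  assoc = solve-∀
  expand : ∀ c y k → c * (1 + y * suc k) ≡ c + c * y * suc k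
  expand = solve-∀
-- Here `x * b` is -1 modulo `suc k`, so the inverse of `b` is `-x`; it is represented by `x * k`,
-- because `k` is -1 as well.
... | Bézout.+- y x eq = c * x * k , c , c * k * y , (begin
  c * x * k * b + c * suc k      ≡⟨ factor c x k b ⟩
  c + c * k * (1 + x * b)        ≡⟨ cong (λ w → c + c * k * w) eq ⟩
  c + c * k * (y * suc k)        ≡⟨ assoc c k y ⟩
  c + c * k * y * suc k          ∎)
  where
  factor : ∀ c x k b → c * x * k * b + c * suc k ≡ c + c * k * (1 + x * b)
  factor = solve-∀
  assoc : ∀ c k y → c + c * k * (y * suc k) ≡ c + c * k * y * suc k
  assoc = solve-∀

-- Taking `t` to be the least residue of c b⁻¹ modulo `a` gives `t ≤ a ∸ 1`, so the bound makes
-- `t * b` fit into `c`, and what is left over is a multiple of `a`.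
two-generated : ∀ {a b c} .{{_ : NonZero a}} → Coprime a b → (a ∸ 1) * b ≤ c →
                ∃₂ λ r t → c ≡ r * a + t * b
two-generated {a} {b} {c} cop bound with solve-mod a b c cop
... | s , u , v , eq = quotient , t , (begin
  c                        ≡⟨ m+[n∸m]≡n tb≤c ⟨
  t * b + ρ                ≡⟨ cong (t * b +_) equality ⟩
  t * b + quotient * a     ≡⟨ +-comm (t * b) (quotient * a) ⟩
  quotient * a + t * b     ∎)
  where
  t = s % a
  ρ = c ∸ t * b

  tb≤c : t * b ≤ c
  tb≤c = ≤-trans (*-monoˡ-≤ b (<⇒≤pred (m%n<n s a))) bound

  multiple : (s / a * b + u) * a ≡ v * a + ρ
  multiple = +-cancelˡ-≡ (t * b) _ _ (begin
    t * b + (s / a * b + u) * a    ≡⟨ collect t (s / a) a b u ⟩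
    (t + s / a * a) * b + u * a    ≡⟨ cong (λ w → w * b + u * a) (m≡m%n+[m/n]*n s a) ⟨
    s * b + u * a                  ≡⟨ eq ⟩
    c + v * a                      ≡⟨ cong (_+ v * a) (m+[n∸m]≡n tb≤c) ⟨
    t * b + ρ + v * a              ≡⟨ swap (t * b) ρ (v * a) ⟩
    t * b + (v * a + ρ)            ∎)
    where
    collect : ∀ t q a b u → t * b + (q * b + u) * a ≡ (t + q * a) * b + u * a
    collect = solve-∀
    swap : ∀ x y z → x + y + z ≡ x + (z + y)
    swap = solve-∀

  a∣ρ : a ∣ ρ
  a∣ρ = ∣m+n∣m⇒∣n (subst (a ∣_) multiple (n∣m*n (s / a * b + u))) (n∣m*n v)

  open _∣_ a∣ρ using (quotient; equality)

-- Vector arithmetic on factorizations.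

infixl 6 _⊕_
_⊕_ : ∀ {e} → Vec ℕ e → Vec ℕ e → Vec ℕ e
_⊕_ = zipWith _+_

infixr 7 _•_
_•_ : ∀ {e} → ℕ → Vec ℕ e → Vec ℕ e
q • u = map (q *_) u

·-distribʳ-⊕ : ∀ {e} (as u v : Vec ℕ e) → (u ⊕ v) · as ≡ u · as + v · as
·-distribʳ-⊕ []       []       []       = refl
·-distribʳ-⊕ (a ∷ as) (x ∷ u) (y ∷ v) = begin
  (x + y) * a + (u ⊕ v) · as          ≡⟨ cong ((x + y) * a +_) (·-distribʳ-⊕ as u v) ⟩
  (x + y) * a + (u · as + v · as)     ≡⟨ regroup x y a (u · as) (v · as) ⟩
  x * a + u · as + (y * a + v · as)   ∎
  where
  regroup : ∀ x y a p q → (x + y) * a + (p + q) ≡ x * a + p + (y * a + q)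
  regroup = solve-∀

replicate-0-· : ∀ {e} (as : Vec ℕ e) → replicate e 0 · as ≡ 0
replicate-0-· []       = refl
replicate-0-· (_ ∷ as) = replicate-0-· as

⊕-0• : ∀ {e} (w u : Vec ℕ e) → w ⊕ 0 • u ≡ w
⊕-0• []      []      = refl
⊕-0• (x ∷ w) (_ ∷ u) = cong₂ _∷_ (+-identityʳ x) (⊕-0• w u)

⊕-suc• : ∀ {e} q (w u : Vec ℕ e) → w ⊕ suc q • u ≡ (w ⊕ u) ⊕ q • u
⊕-suc• q []      []      = refl
⊕-suc• q (x ∷ w) (y ∷ u) = cong₂ _∷_ (sym (+-assoc x y (q * y))) (⊕-suc• q w u)

⊕-swap : ∀ {e} (w u v : Vec ℕ e) → (w ⊕ u) ⊕ v ≡ (w ⊕ v) ⊕ u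
⊕-swap []      []      []      = refl
⊕-swap (x ∷ w) (y ∷ u) (z ∷ v) = cong₂ _∷_ (swap x y z) (⊕-swap w u v)
  where
  swap : ∀ x y z → x + y + z ≡ x + z + y
  swap = solve-∀

-- The minimum of two sums is at least their common summand. Read contrapositively: factorizations
-- sharing a nonzero part are adjacent.
gcdᵛ-⊕≡0⇒≡0 : ∀ {e} (w u v : Vec ℕ e) → gcdᵛ (w ⊕ u) (w ⊕ v) ≡ replicate e 0 → w ≡ replicate e 0
gcdᵛ-⊕≡0⇒≡0 []          []      []      _  = refl
gcdᵛ-⊕≡0⇒≡0 (zero  ∷ w) (_ ∷ u) (_ ∷ v) eq = cong (0 ∷_) (gcdᵛ-⊕≡0⇒≡0 w u v (proj₂ (∷-injective eq)))
gcdᵛ-⊕≡0⇒≡0 (suc _ ∷ _) (_ ∷ _) (_ ∷ _) ()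

∇-sym : ∀ {e} {as : Vec ℕ e} {s} {x y : Z as s} → ∇ as s x y → ∇ as s y x
∇-sym {x = x} {y} xy yx = xy (trans (zipWith-comm ⊓-comm (proj₁ x) (proj₁ y)) yx)

-- Walks made of exchanges.

module _ {e} (as : Vec ℕ e) (s : ℕ) where

  -- The proof for `x` is an input and the one for `y` an output, so walks can be composed on bare
  -- vectors.
  Reaches : Vec ℕ e → Vec ℕ e → Set
  Reaches x y = (p : x · as ≡ s) → ∃ λ p′ → Star (∇ as s) (x , p) (y , p′)

  reaches-refl : ∀ {x} → Reaches x x
  reaches-refl p = p , ε

  reaches-trans : ∀ {x y z} → Reaches x y → Reaches y z → Reaches x z
  reaches-trans xy yz p with xy p
  ... | p′ , path with yz p′
  ... | p″ , path′ = p″ , path ◅◅ path′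

  -- The untouched part `w` lies in both ends. If it were zero, `u` alone would have value `s`,
  -- which `u≉s` forbids.
  exchange₁ : ∀ {u v} → u · as ≡ v · as → u · as ≢ s → ∀ w → Reaches (w ⊕ u) (w ⊕ v)
  exchange₁ {u} {v} u≈v u≉s w p = p′ , edge ◅ ε
    where
    p′ : (w ⊕ v) · as ≡ s
    p′ = begin
      (w ⊕ v) · as        ≡⟨ ·-distribʳ-⊕ as w v ⟩
      w · as + v · as     ≡⟨ cong (w · as +_) u≈v ⟨
      w · as + u · as     ≡⟨ ·-distribʳ-⊕ as w u ⟨
      (w ⊕ u) · as        ≡⟨ p ⟩
      s                   ∎

    edge : ∇ as s (w ⊕ u , p) (w ⊕ v , p′)
    edge eq = u≉s (begin
      u · as                        ≡⟨ cong (_+ u · as) (replicate-0-· as) ⟨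
      replicate e 0 · as + u · as   ≡⟨ cong (λ x → x · as + u · as) (gcdᵛ-⊕≡0⇒≡0 w u v eq) ⟨
      w · as + u · as               ≡⟨ ·-distribʳ-⊕ as w u ⟨
      (w ⊕ u) · as                  ≡⟨ p ⟩
      s                             ∎)

  exchange : ∀ {u v} → u · as ≡ v · as → u · as ≢ s → ∀ q w → Reaches (w ⊕ q • u) (w ⊕ q • v)
  exchange {u} {v} u≈v u≉s zero w =
    subst₂ Reaches (sym (⊕-0• w u)) (sym (⊕-0• w v)) reaches-refl
  exchange {u} {v} u≈v u≉s (suc q) w =
    subst₂ Reaches (sym (⊕-suc• q w u)) (sym (⊕-suc• q w v))
      -- One copy of `u` is parked in the base while the other `q` are exchanged; it is then
      -- exchanged itself, with the new copies of `v` as base.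
      (reaches-trans (exchange u≈v u≉s q (w ⊕ u))
        (subst₂ Reaches (⊕-swap w (q • v) u) (⊕-swap w (q • v) v)
          (exchange₁ u≈v u≉s (w ⊕ q • v))))

-- Disconnectedness is shown below by a property that edges preserve, true at one vertex and false
-- at another.
star-preserves : {V : Set} {_~_ : V → V → Set} (P : V → Set) →
                 (∀ {x y} → x ~ y → P x → P y) → ∀ {x y} → Star _~_ x y → P x → P y
star-preserves P step ε        px = px
star-preserves P step (e ◅ es) px = star-preserves P step es (step e px)

gcdᵛ≡0 : ∀ {x y z x′ y′ z′} → (x ≡ 0 ⊎ x′ ≡ 0) → (y ≡ 0 ⊎ y′ ≡ 0) → (z ≡ 0 ⊎ z′ ≡ 0) →
                gcdᵛ (x ∷ y ∷ z ∷ []) (x′ ∷ y′ ∷ z′ ∷ []) ≡ replicate 3 0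
gcdᵛ≡0 p q r = cong₂ _∷_ (min p) (cong₂ _∷_ (min q) (cong₂ _∷_ (min r) refl))
  where
  min : ∀ {m n} → m ≡ 0 ⊎ n ≡ 0 → m ⊓ n ≡ 0
  min         (inj₁ refl) = refl
  min {m = m} (inj₂ refl) = ⊓-zeroʳ m

-- Coprimality gives `a ∣ y`. A nonzero multiple of `a` already contributes `a * b`, leaving nothing
-- for `x`.
boundary-factorization : ∀ {a b x y} .{{_ : NonZero b}} → Coprime a b →
                         x * a + y * b ≡ a * b → x ≡ 0 ⊎ y ≡ 0
boundary-factorization {a} {b} {x} {y} cop eq
  with coprime-divisor {o = y} cop (∣m+n∣m⇒∣n
         (subst (a ∣_) (trans (sym eq) (cong (x * a +_) (*-comm y b))) (m∣m*n b))
         (n∣m*n x))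
... | divides zero    refl = inj₂ refl
... | divides (suc k) refl with a
...   | zero   = inj₂ (*-comm k 0)
...   | suc a′ = inj₁ (m*n≡0⇒m≡0 x (suc a′)
  (m+n≡0⇒m≡0 (x * suc a′) (+-cancelˡ-≡ (suc a′ * b) _ _ (begin
  suc a′ * b + (x * suc a′ + k * suc a′ * b)  ≡⟨ regroup x k (suc a′) b ⟩
  x * suc a′ + suc k * suc a′ * b             ≡⟨ eq ⟩
  suc a′ * b                                  ≡⟨ +-identityʳ _ ⟨
  suc a′ * b + 0                              ∎))))
  where
  regroup : ∀ x k a b → a * b + (x * a + k * a * b) ≡ x * a + suc k * a * b
  regroup = solve-∀

-- Carries a vanishing found for the quotient `k` over to the full coordinate `k * d`.
rescale : ∀ k d m n → m + k * n ≡ 0 → m + k * d * n ≡ 0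
rescale k d m n eq = begin
  m + k * d * n      ≡⟨ cong₂ _+_ (m+n≡0⇒m≡0 m eq) (swap k d n) ⟩
  d * (k * n)        ≡⟨ cong (d *_) (m+n≡0⇒n≡0 m eq) ⟩
  d * 0              ≡⟨ *-comm d 0 ⟩
  0                  ∎
  where
  swap : ∀ k d n → k * d * n ≡ d * (k * n)
  swap = solve-∀

-- Betti elements of a gluing.

module Gluing {a b c d r t : ℕ}
  (a≢0 : a ≢ 0) (b≢0 : b ≢ 0) (c≢0 : c ≢ 0) (d≢0 : d ≢ 0)
  (a⊥b : Coprime a b) (d⊥c : Coprime d c) (c≡ra+tb : c ≡ r * a + t * b) where

  private instance
    a-nonZero = ≢-nonZero a≢0
    b-nonZero = ≢-nonZero b≢0
    c-nonZero = ≢-nonZero c≢0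
    d-nonZero = ≢-nonZero d≢0

  gens : Vec ℕ 3
  gens = d * a ∷ d * b ∷ c ∷ []

  ·-gens : ∀ x y z → (x ∷ y ∷ z ∷ []) · gens ≡ d * (x * a + y * b) + z * c
  ·-gens x y z = regroup a b c d x y z
    where
    regroup : ∀ a b c d x y z →
              x * (d * a) + (y * (d * b) + (z * c + 0)) ≡ d * (x * a + y * b) + z * c
    regroup = solve-∀

  -- Modulo `d` only `z * c` survives, and `c` is coprime to `d`.
  d∣z : ∀ x y z {e} → (x ∷ y ∷ z ∷ []) · gens ≡ d * e → d ∣ z
  d∣z x y z {e} p = coprime-divisor d⊥c
    (∣m+n∣m⇒∣n (subst (d ∣_) d*e≡ (m∣m*n e)) (m∣m*n (x * a + y * b)))
    where
    d*e≡ : d * e ≡ d * (x * a + y * b) + c * z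
    d*e≡ = trans (sym p) (trans (·-gens x y z) (cong (d * (x * a + y * b) +_) (*-comm z c)))

  a•b≈b•a : (0 ∷ a ∷ 0 ∷ []) · gens ≡ (b ∷ 0 ∷ 0 ∷ []) · gens
  a•b≈b•a = eq a b d
    where
    eq : ∀ a b d → 0 + (a * (d * b) + (0 + 0)) ≡ b * (d * a) + 0
    eq = solve-∀

  a•b≈dab : (0 ∷ a ∷ 0 ∷ []) · gens ≡ d * a * b
  a•b≈dab = eq a b d
    where
    eq : ∀ a b d → 0 + (a * (d * b) + (0 + 0)) ≡ d * a * b
    eq = solve-∀

  d•c≈dc : (0 ∷ 0 ∷ d ∷ []) · gens ≡ d * c
  d•c≈dc = +-identityʳ _

  d•c≈rt : (0 ∷ 0 ∷ d ∷ []) · gens ≡ (r ∷ t ∷ 0 ∷ []) · gens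
  d•c≈rt = begin
    (0 ∷ 0 ∷ d ∷ []) · gens       ≡⟨ d•c≈dc ⟩
    d * c                         ≡⟨ cong (d *_) c≡ra+tb ⟩
    d * (r * a + t * b)           ≡⟨ +-identityʳ _ ⟨
    d * (r * a + t * b) + 0 * c   ≡⟨ ·-gens r t 0 ⟨
    (r ∷ t ∷ 0 ∷ []) · gens       ∎

  data Normal : Vec ℕ 3 → Set where
    normal : ∀ {x y z} → y < a → z < d → Normal (x ∷ y ∷ z ∷ [])

  -- Reading the equation modulo `d` fixes `z`; after cancelling `d`, reading `x * a + y * b` modulo
  -- `a` fixes `y`, and then `x`.
  normal-unique : ∀ {u v} → Normal u → Normal v → u · gens ≡ v · gens → u ≡ v
  normal-unique (normal {x} {y} {z} y<a z<d) (normal {x′} {y′} {z′} y′<a z′<d) eq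
    with residue-unique {p = x * a + y * b} {x′ * a + y′ * b} d⊥c z<d z′<d
           (trans (sym (·-gens x y z)) (trans eq (·-gens x′ y′ z′)))
  ... | refl , eq₂
    with residue-unique {p = x} {x′} a⊥b y<a y′<a
           (trans (cong (_+ y * b) (*-comm a x)) (trans eq₂ (cong (_+ y′ * b) (*-comm x′ a))))
  ... | refl , refl = refl

  normalize : ∀ {s} → d * a * b ≢ s → d * c ≢ s → ∀ u → ∃ λ v → Normal v × Reaches gens s u v
  normalize {s} dab≢s dc≢s (x ∷ y ∷ z ∷ []) =
    _ , normal y<a z<d ,
    -- The order matters: trading blocks of `d` copies of `c` may push the second coordinate past
    -- `a`, whereas the later trade of blocks of `a` leaves `z` alone.
    reaches-trans gens s
      (subst (λ w → Reaches gens s w u₁) split-z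
        (exchange gens s d•c≈rt (λ eq → dc≢s (trans (sym d•c≈dc) eq)) q (x ∷ y ∷ z % d ∷ [])))
      (subst (λ w → Reaches gens s w u₂) split-y
        (exchange gens s a•b≈b•a (λ eq → dab≢s (trans (sym a•b≈dab) eq)) q′
          (x₁ ∷ y₁ % a ∷ z % d ∷ [])))
    where
    q  = z / d
    x₁ = x + q * r
    y₁ = y + q * t
    q′ = y₁ / a
    u₁ = x₁ ∷ y₁ ∷ z % d + q * 0 ∷ []
    u₂ = x₁ + q′ * b ∷ y₁ % a + q′ * 0 ∷ z % d + q′ * 0 ∷ []

    n+q*0≡n : ∀ n q → n + q * 0 ≡ n
    n+q*0≡n = solve-∀

    split-z : (x ∷ y ∷ z % d ∷ []) ⊕ q • (0 ∷ 0 ∷ d ∷ []) ≡ x ∷ y ∷ z ∷ []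
    split-z = cong₂ _∷_ (n+q*0≡n x q)
      (cong₂ _∷_ (n+q*0≡n y q) (cong (_∷ []) (sym (m≡m%n+[m/n]*n z d))))

    split-y : (x₁ ∷ y₁ % a ∷ z % d ∷ []) ⊕ q′ • (0 ∷ a ∷ 0 ∷ []) ≡ u₁
    split-y = cong₂ _∷_ (n+q*0≡n x₁ q′)
      (cong₂ _∷_ (sym (m≡m%n+[m/n]*n y₁ a))
        (cong (_∷ []) (trans (n+q*0≡n (z % d) q′) (sym (n+q*0≡n (z % d) q)))))

    y<a : y₁ % a + q′ * 0 < a
    y<a = subst (_< a) (sym (n+q*0≡n _ q′)) (m%n<n y₁ a)

    z<d : z % d + q′ * 0 < d
    z<d = subst (_< d) (sym (n+q*0≡n _ q′)) (m%n<n z d)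

  connected : ∀ {s} → d * a * b ≢ s → d * c ≢ s → Connected (∇ gens s)
  connected {s} dab≢s dc≢s (u , p) (u′ , p′)
    with normalize dab≢s dc≢s u | normalize dab≢s dc≢s u′
  ... | v , nv , u⇝v | v′ , nv′ , u′⇝v′ with u⇝v p | u′⇝v′ p′
  ... | pv , path | pv′ , path′ with normal-unique nv nv′ (trans pv (sym pv′))
  -- A vertex also carries its equation, so the two walks meet only once these proofs are
  -- identified.
  ... | refl with ≡-irrelevant pv pv′
  ... | refl = path ◅◅ reverse (λ {x} {y} → ∇-sym {x = x} {y}) path′

  -- The invariant is `UsesC`. By `isolated` a vertex with `z ≢ 0` has no other nonzero coordinate,
  -- so any neighbour must share `z` with it; yet `r ∷ t ∷ 0 ∷ []` is a vertex too.
  betti-dc : Betti gens (d * c)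
  betti-dc = (D , d•c≈dc) , ≢-nonZero⁻¹ (d * c) {{m*n≢0 d c}} , λ conn →
    star-preserves UsesC (λ {η} {η′} → step {η} {η′})
      (conn (D , d•c≈dc) (r ∷ t ∷ 0 ∷ [] , trans (sym d•c≈rt) d•c≈dc)) d≢0 refl
    where
    D = 0 ∷ 0 ∷ d ∷ []

    UsesC : Z gens (d * c) → Set
    UsesC (_ ∷ _ ∷ z ∷ [] , _) = z ≢ 0

    -- d divides z, so z = d already exhausts d c.
    isolated : ∀ x y z → (x ∷ y ∷ z ∷ []) · gens ≡ d * c → z ≢ 0 → x ≡ 0 × y ≡ 0
    isolated x y z p z≢0 with d∣z x y z p
    ... | divides zero    refl = contradiction refl z≢0
    ... | divides (suc k) refl =
      m*n≡0⇒m≡0 x a (m+n≡0⇒m≡0 _ rest≡0) , m*n≡0⇒m≡0 y b (m+n≡0⇒n≡0 (x * a) rest≡0)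
      where
      rest≡0 : x * a + y * b ≡ 0
      rest≡0 = *-cancelˡ-≡ _ 0 d (begin
        d * (x * a + y * b)  ≡⟨ m+n≡0⇒m≡0 _ (+-cancelˡ-≡ (d * c) _ _ (begin
          d * c + (d * (x * a + y * b) + k * d * c)   ≡⟨ regroup (d * (x * a + y * b)) d c k ⟩
          d * (x * a + y * b) + suc k * d * c         ≡⟨ ·-gens x y (suc k * d) ⟨
          (x ∷ y ∷ suc k * d ∷ []) · gens             ≡⟨ p ⟩
          d * c                                       ≡⟨ +-identityʳ _ ⟨
          d * c + 0                                   ∎)) ⟩
        0                    ≡⟨ *-comm 0 d ⟩
        d * 0                ∎)
        where
        regroup : ∀ w d c k → d * c + (w + k * d * c) ≡ w + suc k * d * c
        regroup = solve-∀

    step : ∀ {η η′} → ∇ gens (d * c) η η′ → UsesC η → UsesC η′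
    step {x ∷ y ∷ z ∷ [] , p} {_ ∷ _ ∷ _ ∷ [] , _} edge z≢0 z′≡0 with isolated x y z p z≢0
    ... | x≡0 , y≡0 = edge (gcdᵛ≡0 (inj₁ x≡0) (inj₁ y≡0) (inj₂ z′≡0))

  -- A factorization of d a b has z = d z′, and expanding c = r a + t b turns it
  -- into the factorization (x + z′ r, y + z′ t) of a b, whose only options are
  -- (b, 0) and (0, a).
  dab-dichotomy : ∀ x y z → (x ∷ y ∷ z ∷ []) · gens ≡ d * a * b →
                  x + z * r ≡ 0 ⊎ y + z * t ≡ 0
  dab-dichotomy x y z p with d∣z x y z (trans p (*-assoc d a b))
  ... | divides k refl with boundary-factorization {x = x + k * r} {y + k * t} a⊥b
                              (*-cancelˡ-≡ _ _ d (begin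
    d * ((x + k * r) * a + (y + k * t) * b)       ≡⟨ expand d x k r a y t b ⟩
    d * (x * a + y * b) + k * d * (r * a + t * b) ≡⟨ cong (λ w → d * (x * a + y * b) + k * d * w) c≡ra+tb ⟨
    d * (x * a + y * b) + k * d * c               ≡⟨ ·-gens x y (k * d) ⟨
    (x ∷ y ∷ k * d ∷ []) · gens                   ≡⟨ p ⟩
    d * a * b                                     ≡⟨ *-assoc d a b ⟩
    d * (a * b)                                   ∎))
    where
    expand : ∀ d x k r a y t b → d * ((x + k * r) * a + (y + k * t) * b)
                               ≡ d * (x * a + y * b) + k * d * (r * a + t * b)
    expand = solve-∀
  ... | inj₁ eq = inj₁ (rescale k d x r eq)
  ... | inj₂ eq = inj₂ (rescale k d y t eq)

  betti-dab : Betti gens (d * a * b)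
  betti-dab = (A , pA) , ≢-nonZero⁻¹ (d * a * b) {{m*n≢0 (d * a) b {{m*n≢0 d a}}}} , λ conn →
    a≢0 (m+n≡0⇒m≡0 a
      (star-preserves AvoidsB (λ {η} {η′} → step {η} {η′}) (conn (A , pA) (B , a•b≈dab)) refl))
    where
    A = b ∷ 0 ∷ 0 ∷ []
    B = 0 ∷ a ∷ 0 ∷ []

    pA : A · gens ≡ d * a * b
    pA = trans (sym a•b≈b•a) a•b≈dab

    -- The term `z * t` accounts for the copies of `b` hidden in `c`; without it, a vertex using `c`
    -- could lie on either side.
    AvoidsB : Z gens (d * a * b) → Set
    AvoidsB (_ ∷ y ∷ z ∷ [] , _) = y + z * t ≡ 0

    step : ∀ {η η′} → ∇ gens (d * a * b) η η′ → AvoidsB η → AvoidsB η′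
    step {x ∷ y ∷ z ∷ [] , p} {x′ ∷ y′ ∷ z′ ∷ [] , p′} edge y+zt≡0 with dab-dichotomy x′ y′ z′ p′
    ... | inj₂ y′+z′t≡0 = y′+z′t≡0
    -- The ends lie on opposite sides of the dichotomy, so the first two coordinates share nothing.
    -- If both used `c`, then `t` and `r` would both vanish, and `c` with them.
    ... | inj₁ x′+z′r≡0 = contradiction
      (gcdᵛ≡0 (inj₂ (m+n≡0⇒m≡0 x′ x′+z′r≡0)) (inj₁ (m+n≡0⇒m≡0 y y+zt≡0)) z≡0⊎z′≡0) edge
      where
      z≡0⊎z′≡0 : z ≡ 0 ⊎ z′ ≡ 0
      z≡0⊎z′≡0
        with m*n≡0⇒m≡0∨n≡0 z (m+n≡0⇒n≡0 y y+zt≡0)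
           | m*n≡0⇒m≡0∨n≡0 z′ (m+n≡0⇒n≡0 x′ x′+z′r≡0)
      ... | inj₁ z≡0 | _         = inj₁ z≡0
      ... | inj₂ _   | inj₁ z′≡0 = inj₂ z′≡0
      ... | inj₂ t≡0 | inj₂ r≡0  =
        contradiction (trans c≡ra+tb (cong₂ (λ r t → r * a + t * b) r≡0 t≡0)) c≢0

  betti : Betti gens ≐ ｛ d * a * b ｝ ∪ ｛ d * c ｝
  betti = to , λ { (inj₁ refl) → betti-dab ; (inj₂ refl) → betti-dc }
    where
    to : ∀ {s} → Betti gens s → (｛ d * a * b ｝ ∪ ｛ d * c ｝) s
    to {s} (_ , _ , disconnected) with d * a * b ≟ s | d * c ≟ s
    ... | yes eq   | _        = inj₁ eq
    ... | no _     | yes eq   = inj₂ eq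
    ... | no dab≢s | no dc≢s  = contradiction (connected dab≢s dc≢s) disconnected

-- The three families as gluings.

betti-gluing : ∀ {a b c d} → .{{NonZero a}} → .{{NonZero b}} → .{{NonZero c}} → .{{NonZero d}} →
               Coprime a b → Coprime d c → (a ∸ 1) * b ≤ c →
               Betti (d * a ∷ d * b ∷ c ∷ []) ≐ ｛ d * a * b ｝ ∪ ｛ d * c ｝
betti-gluing {a} {b} {c} {d} a⊥b d⊥c bound with two-generated a⊥b bound
... | r , t , eq =
  Gluing.betti {r = r} {t}
    (≢-nonZero⁻¹ a) (≢-nonZero⁻¹ b) (≢-nonZero⁻¹ c) (≢-nonZero⁻¹ d) a⊥b d⊥c eq

theorem4 : (α : ℕ) →
    ((m : ℕ) → m > 0 → 2 ∤ m → m > 6 * α + 2 →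
    Betti (6 ∷ 6 * α + 2 ∷ m ∷ []) ≐ ｛ 18 * α + 6 ｝ ∪ ｛ 2 * m ｝)
    × ((n : ℕ) → 3 ∤ n → n > 6 * α + 3 →
    Betti (6 ∷ 6 * α + 3 ∷ n ∷ []) ≐ ｛ 12 * α + 6 ｝ ∪ ｛ 3 * n ｝)
    × ((p : ℕ) → p > 0 → 2 ∤ p → p > 6 * α + 4 →
    Betti (6 ∷ 6 * α + 4 ∷ p ∷ []) ≐ ｛ 18 * α + 12 ｝ ∪ ｛ 2 * p ｝)
theorem4 α = case-i , case-ii , case-iii
  where
  prime[3] : Prime 3
  prime[3] = from-yes (prime? 3)

  coprime-qα+ρ : ∀ {q ρ} → Prime q → q ∤ ρ → Coprime q (q * α + ρ)
  coprime-qα+ρ pr q∤ρ = prime∧∤⇒coprime pr (λ q∣ → q∤ρ (∣m+n∣m⇒∣n q∣ (m∣m*n α)))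

  nonZero-qα+ρ : ∀ q {ρ} .{{_ : NonZero ρ}} → NonZero (q * α + ρ)
  nonZero-qα+ρ q {ρ} = >-nonZero (≤-trans (>-nonZero⁻¹ ρ) (m≤n+m ρ (q * α)))

  case-i : (m : ℕ) → m > 0 → 2 ∤ m → m > 6 * α + 2 →
    Betti (6 ∷ 6 * α + 2 ∷ m ∷ []) ≐ ｛ 18 * α + 6 ｝ ∪ ｛ 2 * m ｝
  case-i m _ 2∤m m> =
    subst₂ (λ g s → Betti (6 ∷ g ∷ m ∷ []) ≐ ｛ s ｝ ∪ ｛ 2 * m ｝) (gen α) (elt α)
      -- The generators are 2·3, 2(3α+1) and `m`. Since `a ∸ 1` equals `d`, the required bound
      -- `(a ∸ 1) * b` is exactly the second generator.
      (betti-gluing {3} {3 * α + 1} {m} {2}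
        {{_}} {{nonZero-qα+ρ 3}} {{>-nonZero (≤-<-trans z≤n m>)}}
        (coprime-qα+ρ prime[3] (from-no (3 ∣? 1)))
        (prime∧∤⇒coprime prime[2] 2∤m)
        (≤-trans (≤-reflexive (bound α)) (<⇒≤ m>)))
    where
    gen : ∀ α → 2 * (3 * α + 1) ≡ 6 * α + 2
    gen = solve-∀
    elt : ∀ α → 6 * (3 * α + 1) ≡ 18 * α + 6
    elt = solve-∀
    bound : ∀ α → 2 * (3 * α + 1) ≡ 6 * α + 2
    bound = solve-∀

  case-ii : (n : ℕ) → 3 ∤ n → n > 6 * α + 3 →
    Betti (6 ∷ 6 * α + 3 ∷ n ∷ []) ≐ ｛ 12 * α + 6 ｝ ∪ ｛ 3 * n ｝
  case-ii n 3∤n n> =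
    subst₂ (λ g s → Betti (6 ∷ g ∷ n ∷ []) ≐ ｛ s ｝ ∪ ｛ 3 * n ｝) (gen α) (elt α)
      -- The common factor is now 3, with 6 = 3·2. The bound is only 2α+1, which is 4α+2 below the
      -- second generator.
      (betti-gluing {2} {2 * α + 1} {n} {3}
        {{_}} {{nonZero-qα+ρ 2}} {{>-nonZero (≤-<-trans z≤n n>)}}
        (coprime-qα+ρ prime[2] (from-no (2 ∣? 1)))
        (prime∧∤⇒coprime prime[3] 3∤n)
        (≤-trans (bound α) (<⇒≤ n>)))
    where
    gen : ∀ α → 3 * (2 * α + 1) ≡ 6 * α + 3
    gen = solve-∀
    elt : ∀ α → 6 * (2 * α + 1) ≡ 12 * α + 6
    elt = solve-∀
    bound : ∀ α → 1 * (2 * α + 1) ≤ 6 * α + 3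
    bound α = subst (1 * (2 * α + 1) ≤_) (sum α) (m≤m+n _ (4 * α + 2))
      where
      sum : ∀ α → 1 * (2 * α + 1) + (4 * α + 2) ≡ 6 * α + 3
      sum = solve-∀

  case-iii : (p : ℕ) → p > 0 → 2 ∤ p → p > 6 * α + 4 →
    Betti (6 ∷ 6 * α + 4 ∷ p ∷ []) ≐ ｛ 18 * α + 12 ｝ ∪ ｛ 2 * p ｝
  case-iii p _ 2∤p p> =
    subst₂ (λ g s → Betti (6 ∷ g ∷ p ∷ []) ≐ ｛ s ｝ ∪ ｛ 2 * p ｝) (gen α) (elt α)
      -- Again 6 = 2·3, so the bound is the second generator 2(3α+2).
      (betti-gluing {3} {3 * α + 2} {p} {2}
        {{_}} {{nonZero-qα+ρ 3}} {{>-nonZero (≤-<-trans z≤n p>)}}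
        (coprime-qα+ρ prime[3] (from-no (3 ∣? 2)))
        (prime∧∤⇒coprime prime[2] 2∤p)
        (≤-trans (≤-reflexive (bound α)) (<⇒≤ p>)))
    where
    gen : ∀ α → 2 * (3 * α + 2) ≡ 6 * α + 4
    gen = solve-∀
    elt : ∀ α → 6 * (3 * α + 2) ≡ 18 * α + 12
    elt = solve-∀
    bound : ∀ α → 2 * (3 * α + 2) ≡ 6 * α + 4
    bound = solve-∀
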